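{- Let $I$ be a set of problem instances with a size function $\mathrm{size}:I\to[0,\infty)$, let $n\ge1$ be an integer and $d\ge 0$. For each $z\in I$ let $h_1(z),\dots,h_n(z)$ be jointly distributed, discrete $I$-valued random variables with $0\le \mathrm{size}(h_i(z))\le\mathrm{size}(z)$, and let $W(z)$ be a non-negative real random variable. Let $a:[0,\infty)\to[0,\infty)$ and suppose that for $z$ with $\mathrm{size}(z)>d$ the probabilistic recurrence $$W(z)\le a(\mathrm{size}(z))+\sum_{i=1}^n W(h_i(z))$$ holds (in the sense of distributions, as explained in the context). Assume that for all $z$ there exists $k$ such that for all $i_1,\dots,i_k\in\{1,\dots,n\}$ we have $\Pr\left[\mathrm{size}(h_{i_1}(\cdots(h_{i_k}(z))))>d\right]=0$. Let $m:[0,\infty)\to[0,\infty)$ satisfy $0\le m(x)\le x$, with $m(x)/x$ non-decreasing on $(0,\infty)$, and suppose $E\left[\max_{i=1}^n\mathrm{size}(h_i(z))\right]\le m(\mathrm{size}(z))$ for all $z$. Let $g_1:\mathbb{R}\to[0,\infty)$ and $g_2:\mathbb{R}\to(0,\infty)$ be monotone (non-decreasing) functions, with $g_1(x)\ge1$ for all $x>d$, such that for all $z$ with $\mathrm{size}(z)>d$ and all $(y_1,\dots,y_n)$ in the support of the joint distribution of $(h_1(z),\dots,h_n(z))$, $$\sum_{i=1}^n g_1(\mathrm{size}(y_i))\le g_1(\mathrm{size}(z))\qquad\text{and}\qquad\sum_{i=1}^n g_2(\mathrm{size}(y_i))\le g_2(\mathrm{size}(z)).$$ Write $\alpha(x)=a(x)/g_2(x)$,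 and assume that $\alpha(x)=0$ for $x\in[0,d]$ and that $\alpha$ is positive, monotone (non-decreasing) and continuous on $(d,\infty)$. Let $u:\mathbb{R}\to\mathbb{R}$ be a monotone (non-decreasing) function, continuous on $(d,\infty)$, with $u(x)\ge \alpha(x)+u(m(x))$ for all $x\ge 0$, such that $u(x)=u(d)$ for all $x\le d$, and such that $W(z)/g_2(\mathrm{size}(z))\le u(\mathrm{size}(z))$ almost surely whenever $\mathrm{size}(z)\le d$. Let $u':\mathbb{R}\to[0,\infty)$ be an inverse of $u$ above $d$, that is, $u'(u(x))=x$ for $x>d$ and $u(u'(y))=y$ for $y>u(d)$. Then for all $z\in I$ and $r\in\mathbb{R}$ such that $g_1(\mathrm{size}(z))\ge1$, $$\Pr[W(z)>r]\le g_1(\mathrm{size}(z))\cdot D_{r/g_2(\mathrm{size}(z))}(\mathrm{size}(z)),$$ where, for $s\in\mathbb{R}$ and $x\ge 0$, $D_s(x)$ is defined by: 1. if $s\le u(d)$ then $D_s(x)=1$; 2. if $s>u(d)$ then (a) if $x\le d$, $D_s(x)=0$; (b) if $x>d$ and $u(x)\ge s$, $D_s(x)=1$; (c) if $x>d$ and $u(x)<s$, $$D_s(x)=\left(\frac{m(x)}{x}\right)^{\left\lceil\frac{s-u(x)}{\alpha(x)}\right\rceil}\cdot\frac{x}{u'\left(s-\alpha(x)\left\lceil\frac{s-u(x)}{\alpha(x)}\right\rceil\right)}.$$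
   Context: The probabilistic recurrence is a statement about distributions: for all $z$ with $\mathrm{size}(z)>d$ and all $r\in\mathbb{R}$, $$\Pr[W(z)>r]\le\sum_{y_1,\dots,y_n}\Pr\left[(h_1(z),\dots,h_n(z))=(y_1,\dots,y_n)\right]\cdot\Pr\left[\sum_{i=1}^n W(y_i)>r-a(\mathrm{size}(z))\right].$$ In the last factor, $W(y_1),\dots,W(y_n)$ are taken on some common probability space with the given marginal laws; no independence is required. The nested expression $h_{i_1}(\cdots(h_{i_k}(z)))$ denotes the result of $k$ successive (freshly randomized) recursive splittings; the termination assumption is equivalent to: for every $z$ there is $k$ such that whenever $z=z_0,z_1,\dots,z_k$ is a sequence in which each $z_{j+1}$ is a value taken with positive probability by some $h_i(z_j)$, we have $\mathrm{size}(z_k)\le d$. -}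

module Defs where

open import Algebra.Bundles using (CommutativeRing)
open import Axiom.ExcludedMiddle using (ExcludedMiddle)
open import Data.Bool.Base using (if_then_else_)
open import Data.Empty using (⊥-elim)
open import Data.Fin.Base using (Fin)
open import Data.List.Base using (List; map; foldr)
open import Data.List.Relation.Unary.Unique.Propositional using (Unique)
open import Data.Nat.Base as ℕ using (ℕ; zero; suc)
open import Data.Product.Base using (Σ; ∃; _×_; _,_; proj₁; proj₂)
open import Data.Sum.Base using (_⊎_; inj₁; inj₂)
open import Data.Vec.Base as Vec using (Vec; []; _∷_; lookup)
open import Level using (0ℓ; Setω)
open import Relation.Binary.Bundles using (TotalOrder)
open import Relation.Binary.Core using (Rel; _Preserves_⟶_)
open import Relation.Binary.PropositionalEquality.Core using (_≢_)
open import Relation.Binary.Structures using (IsTotalOrder)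
open import Relation.Nullary using (¬_; Dec; yes; no; does)
open import Relation.Unary using (Pred; Satisfiable; Empty; U; ∁; ⋃; _∩_; _≐_)

Classical : Setω
Classical = ∀ {ℓ} → ExcludedMiddle ℓ

-- The real numbers, given up to unique isomorphism as a Dedekind-complete
-- ordered field.  The inverse is total; its value at 0# is unconstrained.

record CompleteOrderedField : Set₁ where
  infix  4 _≤_
  infix  8 _⁻¹
  field
    commutativeRing : CommutativeRing 0ℓ 0ℓ

  open CommutativeRing commutativeRing public renaming (Carrier to ℝ)

  field
    _≤_          : Rel ℝ 0ℓ
    isTotalOrder : IsTotalOrder _≈_ _≤_
    +-monoˡ-≤    : ∀ z → (_+ z) Preserves _≤_ ⟶ _≤_
    *-nonneg     : ∀ {x y} → 0# ≤ x → 0# ≤ y → 0# ≤ x * y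
    0≉1          : ¬ (0# ≈ 1#)
    _⁻¹          : ℝ → ℝ
    ⁻¹-inverseʳ  : ∀ {x} → ¬ (x ≈ 0#) → x * x ⁻¹ ≈ 1#

  UpperBound : Pred ℝ 0ℓ → ℝ → Set
  UpperBound P b = ∀ {x} → P x → x ≤ b

  IsLub : Pred ℝ 0ℓ → ℝ → Set
  IsLub P s = UpperBound P s × (∀ {b} → UpperBound P b → s ≤ b)

  field
    complete : (P : Pred ℝ 0ℓ) → Satisfiable P → ∃ (UpperBound P) → ∃ (IsLub P)

  totalOrder : TotalOrder 0ℓ 0ℓ 0ℓ
  totalOrder = record { isTotalOrder = isTotalOrder }

  open import Relation.Binary.Construct.NonStrictToStrict _≈_ _≤_ public using (_<_)
  open import Algebra.Construct.NaturalChoice.Max totalOrder public using (_⊔_)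
  open import Algebra.Properties.Semiring.Exp semiring public using (_^_)
  open import Algebra.Properties.Semiring.Sum semiring public using (sum)

  infixl 7 _/_
  _/_ : ℝ → ℝ → ℝ
  x / y = x * y ⁻¹

  ∣_∣ : ℝ → ℝ
  ∣ x ∣ = x ⊔ (- x)

  fromℕ : ℕ → ℝ
  fromℕ zero    = 0#
  fromℕ (suc k) = 1# + fromℕ k

  Monotone : (ℝ → ℝ) → Set
  Monotone f = f Preserves _≤_ ⟶ _≤_

  ContinuousAbove : ℝ → (ℝ → ℝ) → Set
  ContinuousAbove d f =
    ∀ x → d < x → ∀ ε → 0# < ε →
    ∃ λ δ → 0# < δ × (∀ y → d < y → ∣ y - x ∣ < δ → ∣ f y - f x ∣ < ε)

  -- The greatest entry of a non-empty vector of non-negative reals.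
  maximum : ∀ {n} → Vec ℝ n → ℝ
  maximum = Vec.foldr′ _⊔_ 0#

  -- HasSum f s: the unordered sum of the non-negative family f converges to s.
  HasSum : {A : Set} → (A → ℝ) → ℝ → Set
  HasSum {A} f = IsLub λ t → Σ (List A) λ ys → Unique ys × t ≈ foldr _+_ 0# (map f ys)


module Probability (ℛ : CompleteOrderedField) where
  open CompleteOrderedField ℛ

  -- ℙ is only meaningful on measurable events.
  record ProbabilitySpace : Set₁ where
    field
      Ω            : Set
      Measurable   : Pred (Pred Ω 0ℓ) 0ℓ
      ℙ            : Pred Ω 0ℓ → ℝ
      Measurable-≐ : ∀ {A B} → A ≐ B → Measurable A → Measurable B
      Measurable-U : Measurable U
      Measurable-∁ : ∀ {A} → Measurable A → Measurable (∁ A)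
      Measurable-⋃ : (A : ℕ → Pred Ω 0ℓ) → (∀ k → Measurable (A k)) → Measurable (⋃ ℕ A)
      ℙ-cong       : ∀ {A B} → A ≐ B → Measurable A → ℙ A ≈ ℙ B
      ℙ-nonneg     : ∀ {A} → Measurable A → 0# ≤ ℙ A
      ℙ-U          : ℙ U ≈ 1#
      ℙ-⋃          : (A : ℕ → Pred Ω 0ℓ) → (∀ k → Measurable (A k)) →
                     (∀ {j k} → j ≢ k → Empty (A j ∩ A k)) →
                     HasSum (λ k → ℙ (A k)) (ℙ (⋃ ℕ A))

    AlmostSurely : Pred Ω 0ℓ → Set₁
    AlmostSurely P = ∃ λ (N : Pred Ω 0ℓ) →
      Measurable N × ℙ N ≈ 0# × (∀ {ω} → ¬ N ω → P ω)

    -- The rays (r, ∞) generate the Borel σ-algebra.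
    BorelMeasurable : (Ω → ℝ) → Set
    BorelMeasurable X = ∀ r → Measurable (λ ω → r < X ω)

  record RandomVariable : Set₁ where
    field
      space : ProbabilitySpace
    open ProbabilitySpace space public
    field
      value      : Ω → ℝ
      measurable : BorelMeasurable value

  open RandomVariable using (value)

  ℙ[_>_] : RandomVariable → ℝ → ℝ
  ℙ[ X > r ] = ℙ (λ ω → r < value X ω)
    where open RandomVariable X using (ℙ)

  -- A joint realisation with marginal laws those of the Xᵢ.  A law on ℝ is
  -- determined by its values on the rays (r, ∞).
  record Coupling {n : ℕ} (X : Fin n → RandomVariable) : Set₁ where
    field
      space : ProbabilitySpace
    open ProbabilitySpace space public
    field
      joint      : Fin n → Ω → ℝ
      measurable : ∀ i → BorelMeasurable (joint i)
      marginal   : ∀ i r → ℙ (λ ω → r < joint i ω) ≈ ℙ[ X i > r ]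

  ℙ[Σ_>_] : ∀ {n} {X : Fin n → RandomVariable} → Coupling X → ℝ → ℝ
  ℙ[Σ C > r ] = ℙ (λ ω → r < sum (λ i → joint i ω))
    where open Coupling C using (ℙ; joint)

  -- A discrete random variable enters only through its law.
  record DiscreteLaw (A : Set) : Set where
    field
      mass        : A → ℝ
      mass-nonneg : ∀ y → 0# ≤ mass y
      mass-total  : HasSum mass 1#

    Support : Pred A 0ℓ
    Support y = 0# < mass y

    -- For non-negative f.
    HasExpectation : (A → ℝ) → ℝ → Set
    HasExpectation f = HasSum (λ y → mass y * f y)

  open DiscreteLaw public

  -- HasNestedProb h (i_k ∷ … ∷ i₁ ∷ []) B z p says that
  -- Pr[ h_{i₁}(⋯(h_{i_k}(z))⋯) ∈ B ] = p, where every application of h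
  -- uses fresh randomness.
  HasNestedProb : {I : Set} {n k : ℕ} → (I → DiscreteLaw (Vec I n)) →
                  Vec (Fin n) k → Pred I 0ℓ → I → ℝ → Set
  HasNestedProb h []       B z p = (B z × p ≈ 1#) ⊎ (¬ B z × p ≈ 0#)
  HasNestedProb {I} h (i ∷ is) B z p = ∃ λ (q : I → ℝ) →
    (∀ w → HasNestedProb h is B w (q w)) ×
    HasExpectation (h z) (λ y → q (lookup y i)) p

  -- The recurrence W(z) ≤ b + W(h₁(z)) + ⋯ + W(hₙ(z)) in distribution.
  RecurrenceAt : {I : Set} {n : ℕ} → (I → DiscreteLaw (Vec I n)) →
                 (I → RandomVariable) → I → ℝ → Set₁
  RecurrenceAt {I} {n} h W z b =
    ∃ λ (C : (y : Vec I n) → Coupling (λ i → W (lookup y i))) →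
    ∀ r → ∃ λ s →
      HasSum (λ y → mass (h z) y * ℙ[Σ C y > r - b ]) s × ℙ[ W z > r ] ≤ s


module Tail (classical : Classical) (ℛ : CompleteOrderedField) where
  open CompleteOrderedField ℛ

  private
    open TotalOrder totalOrder using (total; antisym; ≤-resp-≈)
    import Algebra.Properties.Ring ring as Ringₚ

    +-cancel : ∀ x y → (x + y) - y ≈ x
    +-cancel x y = trans (+-assoc x y (- y)) (trans (+-congˡ (-‿inverseʳ y)) (+-identityʳ x))

    ≤-resp : ∀ {x x′ y y′} → x ≈ x′ → y ≈ y′ → x ≤ y → x′ ≤ y′
    ≤-resp x≈x′ y≈y′ x≤y = proj₁ ≤-resp-≈ y≈y′ (proj₂ ≤-resp-≈ x≈x′ x≤y)

    1≰0 : ¬ (1# ≤ 0#)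
    1≰0 1≤0 = 0≉1 (antisym 0≤1 1≤0)
      where
      0≤-1 : 0# ≤ - 1#
      0≤-1 = ≤-resp (-‿inverseʳ 1#) (+-identityˡ (- 1#)) (+-monoˡ-≤ (- 1#) 1≤0)
      0≤1 : 0# ≤ 1#
      0≤1 = ≤-resp refl
        (trans (sym (Ringₚ.-‿distribˡ-* 1# (- 1#)))
          (trans (-‿cong (*-identityˡ (- 1#))) (Ringₚ.-‿involutive 1#)))
        (*-nonneg 0≤-1 0≤-1)

  archimedean : ∀ t → ∃ λ k → t ≤ fromℕ k
  archimedean t with classical {P = ∃ λ k → t ≤ fromℕ k}
  ... | yes bounded  = bounded
  ... | no unbounded = ⊥-elim (1≰0 1≤0)
    where
    Natural : Pred ℝ 0ℓ
    Natural x = ∃ λ k → x ≈ fromℕ k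

    t-bound : UpperBound Natural t
    t-bound {x} (k , x≈k) with total x t
    ... | inj₁ x≤t = x≤t
    ... | inj₂ t≤x = ⊥-elim (unbounded (k , ≤-resp refl x≈k t≤x))

    lub : ∃ (IsLub Natural)
    lub = complete Natural (0# , 0 , refl) (t , t-bound)

    s : ℝ
    s = proj₁ lub

    s-1-bound : UpperBound Natural (s - 1#)
    s-1-bound (k , x≈k) = ≤-resp
      (trans (+-congʳ (+-comm 1# (fromℕ k))) (trans (+-cancel (fromℕ k) 1#) (sym x≈k))) refl
      (+-monoˡ-≤ (- 1#) (proj₁ (proj₂ lub) (suc k , refl)))

    1≤0 : 1# ≤ 0#
    1≤0 = ≤-resp
      (trans (+-comm s (1# - s)) (trans (+-assoc 1# (- s) s)
        (trans (+-congˡ (-‿inverseˡ s)) (+-identityʳ 1#))))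
      (trans (+-congˡ (+-comm 1# (- s)))
        (trans (sym (+-assoc (s - 1#) (- s) 1#))
        (trans (+-congʳ (+-comm (s - 1#) (- s)))
        (trans (+-congʳ (sym (+-assoc (- s) s (- 1#))))
        (trans (+-congʳ (+-congʳ (-‿inverseˡ s)))
        (trans (+-congʳ (+-identityˡ (- 1#))) (-‿inverseˡ 1#)))))))
      (+-monoˡ-≤ (1# - s) (proj₂ (proj₂ lub) s-1-bound))

  private
    least : (P : Pred ℕ 0ℓ) → ∀ k → P k → ∃ λ j → P j × (∀ i → P i → j ℕ.≤ i)
    least P zero    p = 0 , p , λ _ _ → ℕ.z≤n
    least P (suc k) p with classical {P = P 0}
    ... | yes p₀ = 0 , p₀ , λ _ _ → ℕ.z≤n
    ... | no ¬p₀ with least (λ i → P (suc i)) k p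
    ... | j , pⱼ , min = suc j , pⱼ , λ where
      zero    p₀ → ⊥-elim (¬p₀ p₀)
      (suc i) pᵢ → ℕ.s≤s (min i pᵢ)

  -- The least natural number above t; this is ⌈ t ⌉ for t > 0, the only case
  -- in which it is used below.
  ceiling : ∀ t → ∃ λ k → t ≤ fromℕ k × (∀ j → t ≤ fromℕ j → k ℕ.≤ j)
  ceiling t = least (λ k → t ≤ fromℕ k) (proj₁ (archimedean t)) (proj₂ (archimedean t))

  ⌈_⌉ : ℝ → ℕ
  ⌈ t ⌉ = proj₁ (ceiling t)

  _≤?_ : ∀ x y → Dec (x ≤ y)
  x ≤? y = classical

  module _ (d : ℝ) (m α u u′ : ℝ → ℝ) where

    D : ℝ → ℝ → ℝ
    D s x =
      if does (s ≤? u d) then 1#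
      else if does (x ≤? d) then 0#
      else if does (s ≤? u x) then 1#
      else (m x / x) ^ k * (x / u′ (s - α x * fromℕ k))
      where
      k : ℕ
      k = ⌈ (s - u x) / α x ⌉

{-# OPTIONS --safe #-}
module Submission where

-- The heart of the matter is a Markov-type bound.  Write x = size z.  If
-- d < x and d < q with u(q) ≤ s, then
--   Pr[W(z) > s g₂(x)] ≤ g₁(x) x / q.
-- This is trivial for q ≤ x.  For x < q the recurrence and the union bound
-- reduce it to the children of z with s − α(x) in place of s; since
-- s − α(x) ≥ u(q) − α(q) ≥ u(m(q)), the bound for the children holds with
-- m(q) in place of q, and averaging their maximal size gives
-- g₁(x) m(x) / m(q) ≤ g₁(x) x / q, because m(x)/x is non-decreasing.
-- Unfolding the recurrence k more times with q fixed gives, as soon as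
-- u(q) ≤ s − k α(x),
--   Pr[W(z) > s g₂(x)] ≤ g₁(x) x (m(x)/x)ᵏ / q,
-- and the theorem is the case k = ⌈(s − u(x))/α(x)⌉, q = u′(s − k α(x)).

import Algebra.Construct.NaturalChoice.Max as Max
open import Data.Bool.Base using (if_then_else_)
open import Data.Fin.Base as Fin using (Fin; zero; suc)
open import Data.List.Base as List using (List; []; _∷_; foldr)
open import Data.List.Relation.Unary.All using (All; []; _∷_)
open import Data.List.Relation.Unary.AllPairs using ([]; _∷_)
open import Data.List.Relation.Unary.Unique.Propositional using (Unique)
open import Data.Nat.Base as ℕ using (ℕ; zero; suc; NonZero)
import Data.Nat.Properties as ℕ
open import Data.Product.Base using (∃; _×_; _,_; proj₁; proj₂)
open import Data.Sum.Base using (inj₁; inj₂)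
open import Data.Vec.Base using (Vec; []; _∷_; lookup; map)
open import Defs
open import Level using (0ℓ)
open import Relation.Binary.Bundles using (TotalOrder)
open import Relation.Binary.Core using (_Preserves_⟶_; _Preserves₂_⟶_⟶_)
open import Relation.Binary.PropositionalEquality.Core as ≡ using (_≢_)
open import Relation.Nullary using (¬_; Dec; yes; no; does; contradiction)
open import Relation.Nullary.Decidable using (decidable-stable)
open import Relation.Unary using (Pred; U; ∅; ∁; ⋃; _∩_; _∪_; _⊆_)

-- Order and arithmetic in the field; finite and unordered sums.

module OrderedField (classical : Classical) (ℛ : CompleteOrderedField) where
  open CompleteOrderedField ℛ hiding (zero)
  open TotalOrder totalOrder public using (poset; total; antisym; ≤-respˡ-≈; ≤-respʳ-≈)
    renaming (refl to ≤-refl; reflexive to ≤-reflexive; trans to ≤-trans)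
  open import Relation.Binary.Properties.TotalOrder totalOrder public
    using (<-irrefl; <-trans; <⇒≱; ≰⇒>; ≰⇒≥)
  open import Relation.Binary.Construct.NonStrictToStrict _≈_ _≤_ public using (<⇒≤)
  open import Algebra.Construct.NaturalChoice.MaxOp
    (Max.maxOperator totalOrder) public using (x≤x⊔y; x≤y⊔x)
  open import Relation.Binary.Reasoning.PartialOrder poset
  import Algebra.Properties.Ring ring as Ringₚ

  <-≤-trans : ∀ {x y z} → x < y → y ≤ z → x < z
  <-≤-trans {x} {y} {z} x<y y≤z = begin-strict x <⟨ x<y ⟩ y ≤⟨ y≤z ⟩ z ∎

  ≤-<-trans : ∀ {x y z} → x ≤ y → y < z → x < z
  ≤-<-trans {x} {y} {z} x≤y y<z = begin-strict x ≤⟨ x≤y ⟩ y <⟨ y<z ⟩ z ∎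

  +-monoʳ-≤ : ∀ z → (z +_) Preserves _≤_ ⟶ _≤_
  +-monoʳ-≤ z {x} {y} x≤y = begin
    z + x ≈⟨ +-comm z x ⟩
    x + z ≤⟨ +-monoˡ-≤ z x≤y ⟩
    y + z ≈⟨ +-comm y z ⟩
    z + y ∎

  +-mono-≤ : _+_ Preserves₂ _≤_ ⟶ _≤_ ⟶ _≤_
  +-mono-≤ {x} {y} {z} {w} x≤y z≤w = ≤-trans (+-monoˡ-≤ z x≤y) (+-monoʳ-≤ y z≤w)

  x+y-y≈x : ∀ x y → (x + y) - y ≈ x
  x+y-y≈x x y = trans (+-assoc x y (- y)) (trans (+-congˡ (-‿inverseʳ y)) (+-identityʳ x))

  x-y+y≈x : ∀ x y → (x - y) + y ≈ x
  x-y+y≈x x y = trans (+-assoc x (- y) y) (trans (+-congˡ (-‿inverseˡ y)) (+-identityʳ x))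

  +-cancelʳ-≤ : ∀ {x y} z → x + z ≤ y + z → x ≤ y
  +-cancelʳ-≤ {x} {y} z x+z≤y+z = begin
    x           ≈⟨ x+y-y≈x x z ⟨
    (x + z) - z ≤⟨ +-monoˡ-≤ (- z) x+z≤y+z ⟩
    (y + z) - z ≈⟨ x+y-y≈x y z ⟩
    y           ∎

  +-monoˡ-< : ∀ z → (_+ z) Preserves _<_ ⟶ _<_
  +-monoˡ-< z x<y = ≰⇒> λ y+z≤x+z → <⇒≱ x<y (+-cancelʳ-≤ z y+z≤x+z)

  +-cancelʳ-< : ∀ {x y} z → x + z < y + z → x < y
  +-cancelʳ-< z x+z<y+z = ≰⇒> λ y≤x → <⇒≱ x+z<y+z (+-monoˡ-≤ z y≤x)

  x+y≤z⇒x≤z-y : ∀ {x y z} → x + y ≤ z → x ≤ z - y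
  x+y≤z⇒x≤z-y {x} {y} {z} p = +-cancelʳ-≤ y (≤-respʳ-≈ (sym (x-y+y≈x z y)) p)

  x≤z-y⇒x+y≤z : ∀ {x y z} → x ≤ z - y → x + y ≤ z
  x≤z-y⇒x+y≤z {x} {y} {z} p = ≤-respʳ-≈ (x-y+y≈x z y) (+-monoˡ-≤ y p)

  0≤1 : 0# ≤ 1#
  0≤1 with total 0# 1#
  ... | inj₁ 0≤1 = 0≤1
  ... | inj₂ 1≤0 = begin
    0#          ≤⟨ *-nonneg 0≤-1 0≤-1 ⟩
    - 1# * - 1# ≈⟨ Ringₚ.-1*x≈-x (- 1#) ⟩
    - - 1#      ≈⟨ Ringₚ.-‿involutive 1# ⟩
    1#          ∎
    where
    0≤-1 : 0# ≤ - 1#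
    0≤-1 = ≤-respʳ-≈ (+-identityˡ (- 1#)) (x+y≤z⇒x≤z-y (≤-respˡ-≈ (sym (+-identityˡ 1#)) 1≤0))

  0<1 : 0# < 1#
  0<1 = 0≤1 , 0≉1

  *-monoˡ-≤ : ∀ {z} → 0# ≤ z → (_* z) Preserves _≤_ ⟶ _≤_
  *-monoˡ-≤ {z} 0≤z {x} {y} x≤y = begin
    x * z                  ≈⟨ +-identityˡ (x * z) ⟨
    0# + x * z             ≤⟨ +-monoˡ-≤ (x * z) (*-nonneg 0≤y-x 0≤z) ⟩
    (y - x) * z + x * z    ≈⟨ distribʳ z (y - x) x ⟨
    ((y - x) + x) * z      ≈⟨ *-congʳ (x-y+y≈x y x) ⟩
    y * z                  ∎
    where
    0≤y-x : 0# ≤ y - x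
    0≤y-x = x+y≤z⇒x≤z-y (≤-respˡ-≈ (sym (+-identityˡ x)) x≤y)

  *-monoʳ-≤ : ∀ {z} → 0# ≤ z → (z *_) Preserves _≤_ ⟶ _≤_
  *-monoʳ-≤ {z} 0≤z {x} {y} x≤y = begin
    z * x ≈⟨ *-comm z x ⟩
    x * z ≤⟨ *-monoˡ-≤ 0≤z x≤y ⟩
    y * z ≈⟨ *-comm y z ⟩
    z * y ∎

  >⇒≉ : ∀ {x} → 0# < x → ¬ (x ≈ 0#)
  >⇒≉ 0<x x≈0 = <-irrefl (sym x≈0) 0<x

  x/y*y≈x : ∀ x {y} → 0# < y → x / y * y ≈ x
  x/y*y≈x x {y} 0<y = begin-equality
    x * y ⁻¹ * y   ≈⟨ *-assoc x (y ⁻¹) y ⟩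
    x * (y ⁻¹ * y) ≈⟨ *-congˡ (trans (*-comm (y ⁻¹) y) (⁻¹-inverseʳ (>⇒≉ 0<y))) ⟩
    x * 1#         ≈⟨ *-identityʳ x ⟩
    x              ∎

  x*y/y≈x : ∀ x {y} → 0# < y → x * y / y ≈ x
  x*y/y≈x x {y} 0<y = begin-equality
    x * y * y ⁻¹   ≈⟨ *-assoc x y (y ⁻¹) ⟩
    x * (y * y ⁻¹) ≈⟨ *-congˡ (⁻¹-inverseʳ (>⇒≉ 0<y)) ⟩
    x * 1#         ≈⟨ *-identityʳ x ⟩
    x              ∎

  0<x⇒0<x⁻¹ : ∀ {x} → 0# < x → 0# < x ⁻¹
  0<x⇒0<x⁻¹ {x} 0<x = ≰⇒> λ x⁻¹≤0 → <⇒≱ 0<1 (begin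
    1#       ≈⟨ ⁻¹-inverseʳ (>⇒≉ 0<x) ⟨
    x * x ⁻¹ ≤⟨ *-monoʳ-≤ (<⇒≤ 0<x) x⁻¹≤0 ⟩
    x * 0#   ≈⟨ zeroʳ x ⟩
    0#       ∎)

  *-cancelʳ-≤ : ∀ {x y z} → 0# < z → x * z ≤ y * z → x ≤ y
  *-cancelʳ-≤ {x} {y} {z} 0<z xz≤yz = begin
    x         ≈⟨ x*y/y≈x x 0<z ⟨
    x * z / z ≤⟨ *-monoˡ-≤ (<⇒≤ (0<x⇒0<x⁻¹ 0<z)) xz≤yz ⟩
    y * z / z ≈⟨ x*y/y≈x y 0<z ⟩
    y         ∎

  *-monoˡ-< : ∀ {z} → 0# < z → (_* z) Preserves _<_ ⟶ _<_
  *-monoˡ-< 0<z x<y = ≰⇒> λ yz≤xz → <⇒≱ x<y (*-cancelʳ-≤ 0<z yz≤xz)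

  *-cancelʳ-< : ∀ {x y z} → 0# < z → x * z < y * z → x < y
  *-cancelʳ-< 0<z xz<yz = ≰⇒> λ y≤x → <⇒≱ xz<yz (*-monoˡ-≤ (<⇒≤ 0<z) y≤x)

  *-pos : ∀ {x y} → 0# < x → 0# < y → 0# < x * y
  *-pos {x} {y} 0<x 0<y = begin-strict
    0#     ≈⟨ zeroˡ y ⟨
    0# * y <⟨ *-monoˡ-< 0<y 0<x ⟩
    x * y  ∎

  x≤y/z : ∀ {x y z} → 0# < z → x * z ≤ y → x ≤ y / z
  x≤y/z {x} {y} {z} 0<z p = *-cancelʳ-≤ 0<z (≤-respʳ-≈ (sym (x/y*y≈x y 0<z)) p)

  x/y≤z⇒x≤z*y : ∀ {x y z} → 0# < y → x / y ≤ z → x ≤ z * y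
  x/y≤z⇒x≤z*y {x} {y} 0<y p = ≤-respˡ-≈ (x/y*y≈x x 0<y) (*-monoˡ-≤ (<⇒≤ 0<y) p)

  *≤0⇒≤0 : ∀ {x y} → 0# < x → x * y ≤ 0# → y ≤ 0#
  *≤0⇒≤0 {x} {y} 0<x xy≤0 = *-cancelʳ-≤ 0<x (begin
    y * x  ≈⟨ *-comm y x ⟩
    x * y  ≤⟨ xy≤0 ⟩
    0#     ≈⟨ zeroˡ x ⟨
    0# * x ∎)

  ^-nonneg : ∀ {x} → 0# ≤ x → ∀ k → 0# ≤ x ^ k
  ^-nonneg 0≤x zero    = 0≤1
  ^-nonneg 0≤x (suc k) = *-nonneg 0≤x (^-nonneg 0≤x k)

  ^-monoˡ-≤ : ∀ {x y} → 0# ≤ x → x ≤ y → ∀ k → x ^ k ≤ y ^ k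
  ^-monoˡ-≤ 0≤x x≤y zero    = ≤-refl
  ^-monoˡ-≤ {x} {y} 0≤x x≤y (suc k) = begin
    x * x ^ k ≤⟨ *-monoˡ-≤ (^-nonneg 0≤x k) x≤y ⟩
    y * x ^ k ≤⟨ *-monoʳ-≤ (≤-trans 0≤x x≤y) (^-monoˡ-≤ 0≤x x≤y k) ⟩
    y * y ^ k ∎

  fromℕ-nonneg : ∀ k → 0# ≤ fromℕ k
  fromℕ-nonneg zero    = ≤-refl
  fromℕ-nonneg (suc k) = ≤-respˡ-≈ (+-identityˡ 0#) (+-mono-≤ 0≤1 (fromℕ-nonneg k))

  fromℕ-pos : ∀ k → 0# < fromℕ (suc k)
  fromℕ-pos k = <-≤-trans 0<1 (≤-respˡ-≈ (+-identityʳ 1#) (+-monoʳ-≤ 1# (fromℕ-nonneg k)))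

  sum-mono : ∀ {n} {f g : Fin n → ℝ} → (∀ i → f i ≤ g i) → sum f ≤ sum g
  sum-mono {zero}  f≤g = ≤-refl
  sum-mono {suc n} f≤g = +-mono-≤ (f≤g zero) (sum-mono λ i → f≤g (suc i))

  lookup≤maximum : ∀ {A : Set} {n} (f : A → ℝ) (xs : Vec A n) i →
                   f (lookup xs i) ≤ maximum (map f xs)
  lookup≤maximum f (x ∷ xs) zero    = x≤x⊔y _ _
  lookup≤maximum f (x ∷ xs) (suc i) = ≤-trans (lookup≤maximum f xs i) (x≤y⊔x _ _)

  maximum-nonneg : ∀ {n} (xs : Vec ℝ n) → 0# ≤ maximum xs
  maximum-nonneg []       = ≤-refl
  maximum-nonneg (x ∷ xs) = ≤-trans (maximum-nonneg xs) (x≤y⊔x _ _)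

  hasSum-term : ∀ {A : Set} {f : A → ℝ} {s} → HasSum f s → ∀ x → f x ≤ s
  hasSum-term {f = f} f-sum x =
    ≤-respˡ-≈ (+-identityʳ (f x)) (proj₁ f-sum (x ∷ [] , ([] ∷ []) , refl))

  -- Every finite partial sum of `f` is at most `c` times the partial sum of `g` over the same list,
  -- hence at most `c * t`, and `s` is the least such bound. With the factor `c` built in, it is
  -- never necessary to show that unordered sums commute with scaling.
  hasSum-≤* : ∀ {A : Set} {f g : A → ℝ} {s t c} → 0# ≤ c → HasSum f s → HasSum g t →
              (∀ x → f x ≤ c * g x) → s ≤ c * t
  hasSum-≤* {A} {f} {g} {s} {t} {c} 0≤c f-sum g-sum f≤cg = proj₂ f-sum
    λ { {v} (xs , unique , v≈) → begin
      v                              ≈⟨ v≈ ⟩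
      foldr _+_ 0# (List.map f xs)        ≤⟨ partial xs ⟩
      c * foldr _+_ 0# (List.map g xs)    ≤⟨ *-monoʳ-≤ 0≤c (proj₁ g-sum (xs , unique , refl)) ⟩
      c * t                          ∎ }
    where
    partial : ∀ xs → foldr _+_ 0# (List.map f xs) ≤ c * foldr _+_ 0# (List.map g xs)
    partial []       = ≤-reflexive (sym (zeroʳ c))
    partial (x ∷ xs) = ≤-respʳ-≈ (sym (distribˡ c _ _)) (+-mono-≤ (f≤cg x) (partial xs))

-- Finite consequences of countable additivity.

module ProbabilityBounds (classical : Classical) (ℛ : CompleteOrderedField)
                         (S : Probability.ProbabilitySpace ℛ) where
  open CompleteOrderedField ℛ hiding (zero)
  open OrderedField classical ℛ
  open Tail classical ℛ using (archimedean; ceiling)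
  open Probability ℛ
  open ProbabilitySpace S
  open import Algebra.Properties.CommutativeSemigroup +-commutativeSemigroup using (interchange)
  open import Relation.Binary.Reasoning.PartialOrder poset

  private
    -- The sequence concentrated at one index. A family dominated by two such sequences has all its
    -- duplicate-free partial sums bounded by the two values, whichever indices the list contains.
    at : ℕ → ℝ → ℕ → ℝ
    at zero    c zero    = c
    at (suc j) c (suc k) = at j c k
    at _       c _       = 0#

    at-≡ : ∀ j {c} → at j c j ≈ c
    at-≡ zero    = refl
    at-≡ (suc j) = at-≡ j

    at-≢ : ∀ j {c k} → j ≢ k → at j c k ≈ 0#
    at-≢ zero    {k = zero}  j≢k = contradiction ≡.refl j≢k
    at-≢ zero    {k = suc k} j≢k = refl
    at-≢ (suc j) {k = zero}  j≢k = refl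
    at-≢ (suc j) {k = suc k} j≢k = at-≢ j λ j≡k → j≢k (≡.cong suc j≡k)

    Σ[_] : (ℕ → ℝ) → List ℕ → ℝ
    Σ[ f ] ks = foldr _+_ 0# (List.map f ks)

    Σ-at-≢ : ∀ {j c ks} → All (j ≢_) ks → Σ[ at j c ] ks ≈ 0#
    Σ-at-≢         []           = refl
    Σ-at-≢ {j} (j≢k ∷ j≢ks) = trans (+-cong (at-≢ j j≢k) (Σ-at-≢ j≢ks)) (+-identityˡ 0#)

    -- A duplicate-free list contains `j` at most once; `0# ≤ c` covers the lists that miss it.
    Σ-at : ∀ j {c} → 0# ≤ c → ∀ {ks} → Unique ks → Σ[ at j c ] ks ≤ c
    Σ-at j     0≤c [] = 0≤c
    Σ-at j {c} 0≤c {k ∷ ks} (k≢ks ∷ unique) with j ℕ.≟ k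
    ... | yes ≡.refl = ≤-reflexive (trans (+-cong (at-≡ j) (Σ-at-≢ k≢ks)) (+-identityʳ c))
    ... | no  j≢k    =
      ≤-respˡ-≈ (sym (trans (+-congʳ (at-≢ j j≢k)) (+-identityˡ _))) (Σ-at j 0≤c unique)

    Σ-≤-+ : ∀ {f} g h → (∀ k → f k ≤ g k + h k) → ∀ ks → Σ[ f ] ks ≤ Σ[ g ] ks + Σ[ h ] ks
    Σ-≤-+ g h f≤ []       = ≤-reflexive (sym (+-identityˡ 0#))
    Σ-≤-+ g h f≤ (k ∷ ks) =
      ≤-respʳ-≈ (interchange (g k) (h k) _ _) (+-mono-≤ (f≤ k) (Σ-≤-+ g h f≤ ks))

  measurable-∅ : Measurable ∅
  measurable-∅ = Measurable-≐ ((λ ¬tt → ¬tt _) , λ ()) (Measurable-∁ Measurable-U)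

  private
    sequence : Pred Ω 0ℓ → Pred Ω 0ℓ → ℕ → Pred Ω 0ℓ
    sequence A B 0 = A
    sequence A B 1 = B
    sequence A B _ = ∅

    measurable-sequence : ∀ {A B} → Measurable A → Measurable B → ∀ k → Measurable (sequence A B k)
    measurable-sequence A-meas B-meas 0             = A-meas
    measurable-sequence A-meas B-meas 1             = B-meas
    measurable-sequence A-meas B-meas (suc (suc k)) = measurable-∅

  measurable-∪ : ∀ {A B} → Measurable A → Measurable B → Measurable (A ∪ B)
  measurable-∪ {A} {B} A-meas B-meas =
    Measurable-≐ (to , from) (Measurable-⋃ (sequence A B) (measurable-sequence A-meas B-meas))
    where
    to : ⋃ ℕ (sequence A B) ⊆ A ∪ B
    to (0 , a) = inj₁ a
    to (1 , b) = inj₂ b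
    from : A ∪ B ⊆ ⋃ ℕ (sequence A B)
    from (inj₁ a) = 0 , a
    from (inj₂ b) = 1 , b

  measurable-∩ : ∀ {A B} → Measurable A → Measurable B → Measurable (A ∩ B)
  measurable-∩ {A} {B} A-meas B-meas =
    Measurable-≐ (to , from) (Measurable-∁ (measurable-∪ (Measurable-∁ A-meas) (Measurable-∁ B-meas)))
    where
    to : ∁ (∁ A ∪ ∁ B) ⊆ A ∩ B
    to ¬¬ = decidable-stable classical (λ ¬a → ¬¬ (inj₁ ¬a)) ,
            decidable-stable classical (λ ¬b → ¬¬ (inj₂ ¬b))
    from : A ∩ B ⊆ ∁ (∁ A ∪ ∁ B)
    from (a , b) (inj₁ ¬a) = ¬a a
    from (a , b) (inj₂ ¬b) = ¬b b

  -- By excluded middle the event is `U` or `∅`. This serves the empty sum in `measurable-sum`.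
  measurable-const : ∀ P → Measurable (λ _ → P)
  measurable-const P with classical {P = P}
  ... | yes p = Measurable-≐ ((λ _ → p) , λ _ → _) Measurable-U
  ... | no ¬p = Measurable-≐ ((λ ()) , λ p → contradiction p ¬p) measurable-∅

  -- The constant sequence `∅` is pairwise disjoint with union `∅`, so two of its terms already give
  -- `ℙ ∅ + ℙ ∅ ≤ ℙ ∅`.
  ℙ-∅ : ℙ ∅ ≈ 0#
  ℙ-∅ = antisym (+-cancelʳ-≤ (ℙ ∅) (begin
      ℙ ∅ + ℙ ∅                 ≈⟨ +-congˡ (+-identityʳ (ℙ ∅)) ⟨
      ℙ ∅ + (ℙ ∅ + 0#)          ≤⟨ proj₁ sum-∅ (0 ∷ 1 ∷ [] , ((λ ()) ∷ []) ∷ [] ∷ [] , refl) ⟩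
      ℙ (⋃ ℕ λ _ → ∅)           ≈⟨ ℙ-cong ((λ ()) , λ ()) (Measurable-⋃ _ λ _ → measurable-∅) ⟩
      ℙ ∅                       ≈⟨ +-identityˡ (ℙ ∅) ⟨
      0# + ℙ ∅                  ∎))
    (ℙ-nonneg measurable-∅)
    where
    sum-∅ : HasSum (λ _ → ℙ ∅) (ℙ (⋃ ℕ λ _ → ∅))
    sum-∅ = ℙ-⋃ (λ _ → ∅) (λ _ → measurable-∅) λ _ _ ()

  -- Countable additivity is applied to the sequence A, B, ∅, ∅, ….
  private
    module Disjoint {A B} (A-meas : Measurable A) (B-meas : Measurable B)
                    (disjoint : ∀ {ω} → A ω → ¬ B ω) where
      union-sum : HasSum (λ k → ℙ (sequence A B k)) (ℙ (⋃ ℕ (sequence A B)))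
      union-sum = ℙ-⋃ (sequence A B) (measurable-sequence A-meas B-meas) empty
        where
        empty : ∀ {j k} → j ≢ k → ∀ ω → ¬ (sequence A B j ∩ sequence A B k) ω
        empty {0} {0} 0≢0 ω _       = 0≢0 ≡.refl
        empty {0} {1} _   ω (a , b) = disjoint a b
        empty {1} {0} _   ω (b , a) = disjoint a b
        empty {1} {1} 1≢1 ω _       = 1≢1 ≡.refl

      lower : ℙ A ≤ ℙ (⋃ ℕ (sequence A B))
      lower = hasSum-term union-sum 0

      upper : ℙ (⋃ ℕ (sequence A B)) ≤ ℙ A + ℙ B
      upper = proj₂ union-sum λ { {v} (ks , unique , v≈) → begin
        v                                   ≈⟨ v≈ ⟩
        Σ[ (λ k → ℙ (sequence A B k)) ] ks  ≤⟨ Σ-≤-+ _ _ bound ks ⟩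
        Σ[ at 0 (ℙ A) ] ks + Σ[ at 1 (ℙ B) ] ks
          ≤⟨ +-mono-≤ (Σ-at 0 (ℙ-nonneg A-meas) unique) (Σ-at 1 (ℙ-nonneg B-meas) unique) ⟩
        ℙ A + ℙ B                           ∎ }
        where
        bound : ∀ k → ℙ (sequence A B k) ≤ at 0 (ℙ A) k + at 1 (ℙ B) k
        bound 0             = ≤-reflexive (sym (+-identityʳ _))
        bound 1             = ≤-reflexive (sym (+-identityˡ _))
        bound (suc (suc k)) = ≤-reflexive (trans ℙ-∅ (sym (+-identityˡ 0#)))

      measurable-union : Measurable (⋃ ℕ (sequence A B))
      measurable-union = Measurable-⋃ _ (measurable-sequence A-meas B-meas)

  -- `B` is the disjoint union of `A` and `B ∩ ∁ A`, and `lower` keeps only the first piece.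
  ℙ-mono : ∀ {A B} → Measurable A → Measurable B → A ⊆ B → ℙ A ≤ ℙ B
  ℙ-mono {A} {B} A-meas B-meas A⊆B =
    ≤-respʳ-≈ (ℙ-cong (to , from) measurable-union) lower
    where
    open Disjoint A-meas (measurable-∩ B-meas (Measurable-∁ A-meas)) (λ a b → proj₂ b a)
    to : ⋃ ℕ (sequence A (B ∩ ∁ A)) ⊆ B
    to (0 , a) = A⊆B a
    to (1 , b) = proj₁ b
    from : B ⊆ ⋃ ℕ (sequence A (B ∩ ∁ A))
    from {ω} b with classical {P = A ω}
    ... | yes a = 0 , a
    ... | no ¬a = 1 , b , ¬a

  ℙ≤1 : ∀ {A} → Measurable A → ℙ A ≤ 1#
  ℙ≤1 A-meas = ≤-respʳ-≈ ℙ-U (ℙ-mono A-meas Measurable-U _)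

  ℙ-split : ∀ {E A} → Measurable E → Measurable A → ℙ E ≤ ℙ A + ℙ (E ∩ ∁ A)
  ℙ-split {E} {A} E-meas A-meas = ≤-trans (ℙ-mono E-meas measurable-union cover) upper
    where
    open Disjoint A-meas (measurable-∩ E-meas (Measurable-∁ A-meas)) (λ a e → proj₂ e a)
    cover : E ⊆ ⋃ ℕ (sequence A (E ∩ ∁ A))
    cover {ω} e with classical {P = A ω}
    ... | yes a = 0 , a
    ... | no ¬a = 1 , e , ¬a

  -- Induction on `n`: split off the part of `E` inside `A zero`; the remainder is covered by the
  -- other events. Bounding an arbitrary covered `E`, not just the union itself, makes the induction
  -- hypothesis fit this remainder.
  ℙ-union-bound : ∀ {n} {A : Fin n → Pred Ω 0ℓ} {E} → (∀ i → Measurable (A i)) → Measurable E →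
                  E ⊆ ⋃ (Fin n) A → ℙ E ≤ sum (λ i → ℙ (A i))
  ℙ-union-bound {zero} A-meas E-meas E⊆ =
    ≤-respʳ-≈ ℙ-∅ (ℙ-mono E-meas measurable-∅ λ e → contradiction (proj₁ (E⊆ e)) λ ())
  ℙ-union-bound {suc n} {A} {E} A-meas E-meas E⊆ = ≤-trans
    (ℙ-split E-meas (A-meas zero))
    (+-monoʳ-≤ _ (ℙ-union-bound (λ i → A-meas (suc i))
      (measurable-∩ E-meas (Measurable-∁ (A-meas zero))) rest))
    where
    rest : E ∩ ∁ (A zero) ⊆ ⋃ (Fin n) (λ i → A (suc i))
    rest (e , ¬a) with E⊆ e
    ... | zero  , a = contradiction a ¬a
    ... | suc i , a = i , a

  -- Density of a grid and measurability of finite sums.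

  -- A countable dense set, without a detour through ℚ; l allows for negative points.
  grid : ℕ → ℕ → ℕ → ℝ
  grid j k l = (fromℕ (suc k) - fromℕ l) / fromℕ (suc j)

  -- Scaling by `N` stretches the gap to length at least 2, and shifting by `l` makes the left end
  -- `t` non-negative. For the least natural number `k` with `t ≤ k`, the number `1 + k` then lies
  -- strictly between `t` and `t + 2`.
  grid-dense : ∀ {x y} → x < y → ∃ λ j → ∃ λ k → ∃ λ l → x < grid j k l × grid j k l < y
  grid-dense {x} {y} x<y = j , k , l , *-cancelʳ-< N>0 x<g , *-cancelʳ-< N>0 g<y
    where
    δ : ℝ
    δ = y - x
    0<δ : 0# < δ
    0<δ = +-cancelʳ-< x (begin-strict
      0# + x ≈⟨ +-identityˡ x ⟩
      x      <⟨ x<y ⟩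
      y      ≈⟨ x-y+y≈x y x ⟨
      δ + x  ∎)
    two : ℝ
    two = 1# + 1#
    j : ℕ
    j = proj₁ (archimedean (two / δ))
    N : ℝ
    N = fromℕ (suc j)
    N>0 : 0# < N
    N>0 = fromℕ-pos j
    two≤δN : two ≤ δ * N
    two≤δN = begin
      two           ≈⟨ x/y*y≈x two 0<δ ⟨
      two / δ * δ   ≤⟨ *-monoˡ-≤ (<⇒≤ 0<δ) (proj₂ (archimedean (two / δ))) ⟩
      fromℕ j * δ   ≤⟨ *-monoˡ-≤ (<⇒≤ 0<δ) (≤-respˡ-≈ (+-identityˡ _) (+-monoˡ-≤ (fromℕ j) 0≤1)) ⟩
      N * δ         ≈⟨ *-comm N δ ⟩
      δ * N         ∎
    l : ℕ
    l = proj₁ (archimedean (- (x * N)))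
    t : ℝ
    t = x * N + fromℕ l
    0≤t : 0# ≤ t
    0≤t = begin
      0#                     ≈⟨ -‿inverseʳ (x * N) ⟨
      x * N - x * N          ≤⟨ +-monoʳ-≤ (x * N) (proj₂ (archimedean (- (x * N)))) ⟩
      t                      ∎
    k : ℕ
    k = proj₁ (ceiling t)
    t<1+k : t < fromℕ (suc k)
    t<1+k = begin-strict
      t               ≤⟨ proj₁ (proj₂ (ceiling t)) ⟩
      fromℕ k         ≈⟨ +-identityˡ (fromℕ k) ⟨
      0# + fromℕ k    <⟨ +-monoˡ-< (fromℕ k) 0<1 ⟩
      1# + fromℕ k    ∎
    -- Minimality bounds the predecessor of a positive `i` by `t`; for `i = 0` there is no
    -- predecessor, and `0≤t` is used instead.
    below : ∀ i → (∀ j → t ≤ fromℕ j → i ℕ.≤ j) → fromℕ i < 1# + t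
    below zero    least = <-≤-trans 0<1 (≤-respˡ-≈ (+-identityʳ 1#) (+-monoʳ-≤ 1# 0≤t))
    below (suc i) least = begin-strict
      1# + fromℕ i ≈⟨ +-comm 1# (fromℕ i) ⟩
      fromℕ i + 1# <⟨ +-monoˡ-< 1# (≰⇒> λ t≤i → ℕ.1+n≰n (least i t≤i)) ⟩
      t + 1#       ≈⟨ +-comm t 1# ⟩
      1# + t       ∎
    g*N≈ : grid j k l * N + fromℕ l ≈ fromℕ (suc k)
    g*N≈ = trans (+-congʳ (x/y*y≈x _ N>0)) (x-y+y≈x _ _)
    x<g : x * N < grid j k l * N
    x<g = +-cancelʳ-< (fromℕ l) (begin-strict
      t                           <⟨ t<1+k ⟩
      fromℕ (suc k)               ≈⟨ g*N≈ ⟨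
      grid j k l * N + fromℕ l    ∎)
    g<y : grid j k l * N < y * N
    g<y = +-cancelʳ-< (fromℕ l) (begin-strict
      grid j k l * N + fromℕ l        ≈⟨ g*N≈ ⟩
      1# + fromℕ k                    ≈⟨ +-comm 1# (fromℕ k) ⟩
      fromℕ k + 1#                    <⟨ +-monoˡ-< 1# (below k (proj₂ (proj₂ (ceiling t)))) ⟩
      (1# + t) + 1#                   ≈⟨ trans (+-comm _ 1#) (sym (+-assoc 1# 1# t)) ⟩
      two + t                         ≤⟨ +-monoˡ-≤ t two≤δN ⟩
      δ * N + (x * N + fromℕ l)       ≈⟨ trans (sym (+-assoc _ _ _)) (+-congʳ (sym (distribʳ N δ x))) ⟩
      (δ + x) * N + fromℕ l           ≈⟨ +-congʳ (*-congʳ (x-y+y≈x y x)) ⟩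
      y * N + fromℕ l                 ∎)

  -- `r < X + Y` means `r - Y < X`; a grid point `g` between the two turns the event into a
  -- countable union of the events `g < X` and `r - g < Y`.
  measurable-+ : ∀ {X Y} → BorelMeasurable X → BorelMeasurable Y → BorelMeasurable (λ ω → X ω + Y ω)
  measurable-+ {X} {Y} X-meas Y-meas r = Measurable-≐ (to , from)
    (Measurable-⋃ _ λ j → Measurable-⋃ _ λ k → Measurable-⋃ _ λ l →
      measurable-∩ (X-meas (grid j k l)) (Y-meas (r - grid j k l)))
    where
    to : ⋃ ℕ (λ j → ⋃ ℕ λ k → ⋃ ℕ λ l → λ ω → grid j k l < X ω × r - grid j k l < Y ω) ⊆
         (λ ω → r < X ω + Y ω)
    to {ω} (j , k , l , g<X , r-g<Y) = begin-strict
      r                         ≈⟨ x-y+y≈x r (grid j k l) ⟨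
      (r - grid j k l) + grid j k l <⟨ +-monoˡ-< _ r-g<Y ⟩
      Y ω + grid j k l          ≤⟨ +-monoʳ-≤ (Y ω) (<⇒≤ g<X) ⟩
      Y ω + X ω                 ≈⟨ +-comm (Y ω) (X ω) ⟩
      X ω + Y ω                 ∎
    from : (λ ω → r < X ω + Y ω) ⊆
           ⋃ ℕ (λ j → ⋃ ℕ λ k → ⋃ ℕ λ l → λ ω → grid j k l < X ω × r - grid j k l < Y ω)
    from {ω} r<X+Y with grid-dense (+-cancelʳ-< (Y ω) (≤-<-trans (≤-reflexive (x-y+y≈x r (Y ω))) r<X+Y))
    ... | j , k , l , r-Y<g , g<X = j , k , l , g<X , +-cancelʳ-< (grid j k l) (begin-strict
      (r - grid j k l) + grid j k l ≈⟨ x-y+y≈x r _ ⟩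
      r                             ≈⟨ x-y+y≈x r (Y ω) ⟨
      (r - Y ω) + Y ω               <⟨ +-monoˡ-< (Y ω) r-Y<g ⟩
      grid j k l + Y ω              ≈⟨ +-comm _ (Y ω) ⟩
      Y ω + grid j k l              ∎)

  measurable-sum : ∀ {n} {X : Fin n → Ω → ℝ} → (∀ i → BorelMeasurable (X i)) →
                   BorelMeasurable (λ ω → sum (λ i → X i ω))
  measurable-sum {zero}  X-meas r = measurable-const (r < 0#)
  measurable-sum {suc n} X-meas   = measurable-+ (X-meas zero) (measurable-sum λ i → X-meas (suc i))

-- Termination expressed through nested probabilities.

module Termination (classical : Classical) (ℛ : CompleteOrderedField) where
  open CompleteOrderedField ℛ hiding (zero)
  open OrderedField classical ℛ
  open Probability ℛ
  open import Relation.Binary.Reasoning.PartialOrder poset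

  -- Asking only for p ≤ 0 spares a proof that nested probabilities are non-negative.
  Avoids : {I : Set} {n : ℕ} → (I → DiscreteLaw (Vec I n)) → Pred I 0ℓ → ℕ → I → Set
  Avoids {n = n} h B k z = (is : Vec (Fin n) k) → ∃ λ p → HasNestedProb h is B z p × p ≤ 0#

  module _ {I : Set} {n : ℕ} {h : I → DiscreteLaw (Vec I n)} {B : Pred I 0ℓ} where

    avoids-zero : ∀ {z} → Avoids h B 0 z → ¬ B z
    avoids-zero avoids b with avoids []
    ... | p , inj₁ (_ , p≈1) , p≤0 = <⇒≱ 0<1 (≤-respˡ-≈ p≈1 p≤0)
    ... | p , inj₂ (¬b , _)  , _   = ¬b b

    -- The single term of `y` in the mean is at most `p ≤ 0#`, and its factor `mass y` is positive,
    -- so the other factor is at most 0.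
    avoids-suc : ∀ {k z y} → Avoids h B (suc k) z → Support (h z) y →
                 ∀ i → Avoids h B k (lookup y i)
    avoids-suc {y = y} avoids y∈ i is with avoids (i ∷ is)
    ... | p , (q , q-nested , q-mean) , p≤0 =
      q (lookup y i) , q-nested (lookup y i) ,
      *≤0⇒≤0 y∈ (≤-trans (hasSum-term q-mean y) p≤0)

  -- If no mass were positive, comparing `mass` with 0 times itself would bound the total mass 1 by
  -- 0.
  support-nonempty : ∀ {A} (μ : DiscreteLaw A) → ∃ (Support μ)
  support-nonempty {A} μ with classical {P = ∃ (Support μ)}
  ... | yes y∈ = y∈
  ... | no ¬y∈ = contradiction 1≤0 (<⇒≱ 0<1)
    where
    1≤0 : 1# ≤ 0#
    1≤0 = ≤-respʳ-≈ (zeroˡ 1#) (hasSum-≤* ≤-refl (mass-total μ) (mass-total μ) λ y →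
      ≤-respʳ-≈ (sym (zeroˡ (mass μ y)))
        (decidable-stable classical λ mass≰0 → ¬y∈ (y , ≰⇒> mass≰0)))

-- Setting of the recurrence and tails at small instances.

module Recurrence (classical : Classical) (ℛ : CompleteOrderedField) where
  open CompleteOrderedField ℛ hiding (zero)
  open OrderedField classical ℛ
  open Termination classical ℛ
  open Probability ℛ
  open Tail classical ℛ
  open import Algebra.Properties.Ring ring using ([y-z]x≈yx-zx; -0#≈0#)
  open import Algebra.Properties.CommutativeSemigroup *-commutativeSemigroup using (x∙yz≈y∙xz)
  open import Algebra.Properties.Semiring.Sum semiring using (*-distribˡ-sum; *-distribʳ-sum)
  open import Relation.Binary.Reasoning.PartialOrder poset

  module TailBound
    (I : Set) (size : I → ℝ) (size-nonneg : ∀ z → 0# ≤ size z) (n : ℕ) .{{_ : NonZero n}}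
    (d : ℝ) (0≤d : 0# ≤ d) (h : I → DiscreteLaw (Vec I n))
    (size-split : ∀ z y → Support (h z) y → ∀ i → size (lookup y i) ≤ size z)
    (W : I → RandomVariable) (W-nonneg : ∀ z ω → 0# ≤ RandomVariable.value (W z) ω)
    (a : ℝ → ℝ) (recurrence : ∀ z → d < size z → RecurrenceAt h W z (a (size z)))
    (terminates : ∀ z → ∃ λ k → Avoids h (λ w → d < size w) k z)
    (m : ℝ → ℝ) (m-bounds : ∀ x → 0# ≤ x → (0# ≤ m x) × (m x ≤ x))
    (m/x-mono : ∀ x y → 0# < x → x ≤ y → m x / x ≤ m y / y)
    (mean-max : ∀ z → ∃ λ e → HasExpectation (h z) (λ y → maximum (map size y)) e × (e ≤ m (size z)))
    (g₁ g₂ : ℝ → ℝ) (g₁-nonneg : ∀ x → 0# ≤ g₁ x) (g₂-pos : ∀ x → 0# < g₂ x)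
    (1≤g₁ : ∀ x → d < x → 1# ≤ g₁ x)
    (g-split : ∀ z → d < size z → ∀ y → Support (h z) y →
      (sum (λ i → g₁ (size (lookup y i))) ≤ g₁ (size z)) ×
      (sum (λ i → g₂ (size (lookup y i))) ≤ g₂ (size z)))
    (α-pos : ∀ x → d < x → 0# < a x / g₂ x)
    (α-mono : ∀ x y → d < x → x ≤ y → a x / g₂ x ≤ a y / g₂ y)
    (u : ℝ → ℝ) (u-mono : Monotone u)
    (u-step : ∀ x → 0# ≤ x → a x / g₂ x + u (m x) ≤ u x)
    (u-flat : ∀ x → x ≤ d → u x ≈ u d)
    (W-small : ∀ z → size z ≤ d → RandomVariable.AlmostSurely (W z)
      (λ ω → RandomVariable.value (W z) ω / g₂ (size z) ≤ u (size z)))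
    where

    Large : Pred I 0ℓ
    Large z = d < size z

    α ρ : ℝ → ℝ
    α x = a x / g₂ x
    ρ x = m x / x

    0<large : ∀ {x} → d < x → 0# < x
    0<large = ≤-<-trans 0≤d

    measurable-tail : ∀ z r → RandomVariable.Measurable (W z) (λ ω → r < RandomVariable.value (W z) ω)
    measurable-tail z = RandomVariable.measurable (W z)

    tail≤1 : ∀ z r → ℙ[ W z > r ] ≤ 1#
    tail≤1 z r = ProbabilityBounds.ℙ≤1 classical ℛ (RandomVariable.space (W z)) (measurable-tail z r)

    u-d≤u : ∀ x → u d ≤ u x
    u-d≤u x with total x d
    ... | inj₁ x≤d = ≤-reflexive (sym (u-flat x x≤d))
    ... | inj₂ d≤x = u-mono d≤x

    -- The event lies inside the null set off which `W` is at most `u d * g₂ (size z)`.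
    small-tail : ∀ {z s} → size z ≤ d → u d ≤ s → ℙ[ W z > s * g₂ (size z) ] ≤ 0#
    small-tail {z} {s} z≤d ud≤s with W-small z z≤d
    ... | N , N-measurable , ℙN≈0 , bound = ≤-respʳ-≈ ℙN≈0
      (ℙ-mono (measurable-tail z _) N-measurable λ s<W →
        decidable-stable classical λ ¬N → <⇒≱ s<W (x/y≤z⇒x≤z*y (g₂-pos _)
          (≤-trans (bound ¬N) (≤-respˡ-≈ (sym (u-flat _ z≤d)) ud≤s))))
      where open ProbabilityBounds classical ℛ (RandomVariable.space (W z))

    -- By termination, some chain of children of positive probability leads from `z₀` to a small
    -- instance. There `W` is non-negative, so `u d < 0` would make the event of `small-tail`
    -- certain although its probability is 0. An instance is required as a starting point since `I`
    -- may be empty.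
    0≤u-d : I → 0# ≤ u d
    0≤u-d z₀ = descend (proj₁ (terminates z₀)) z₀ (proj₂ (terminates z₀))
      where
      at-small : ∀ z → size z ≤ d → 0# ≤ u d
      at-small z z≤d = decidable-stable classical λ 0≰ud →
        <⇒≱ 0<1 (≤-trans (certain 0≰ud) (small-tail z≤d ≤-refl))
        where
        open RandomVariable (W z)
        open ProbabilityBounds classical ℛ space
        certain : ¬ (0# ≤ u d) → 1# ≤ ℙ[ W z > u d * g₂ (size z) ]
        certain 0≰ud = ≤-respˡ-≈ ℙ-U (ℙ-mono Measurable-U (measurable _) λ {ω} _ → begin-strict
          u d * g₂ (size z) <⟨ *-monoˡ-< (g₂-pos _) (≰⇒> 0≰ud) ⟩
          0# * g₂ (size z)  ≈⟨ zeroˡ _ ⟩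
          0#                ≤⟨ W-nonneg z ω ⟩
          value ω           ∎)

      descend : ∀ k z → Avoids h Large k z → 0# ≤ u d
      descend k z avoids with classical {P = d < size z}
      descend k z avoids | no ¬large = at-small z (decidable-stable classical λ z≰d → ¬large (≰⇒> z≰d))
      descend zero    z avoids | yes large = contradiction large (avoids-zero avoids)
      descend (suc k) z avoids | yes large with support-nonempty (h z)
      ... | y , y∈ = descend k (lookup y i) (avoids-suc avoids y∈ i)
        where
        -- Any child continues the chain; the first exists because `n` is non-zero.
        i : Fin n
        i = Fin.fromℕ< (ℕ.>-nonZero⁻¹ n)

    -- One unfolding of the recurrence.

    -- Union bound: if W(yᵢ) ≤ (s - α x) g₂(yᵢ) for all i, then a x + Σᵢ W(yᵢ) ≤ s g₂(x).
    one-step : ∀ {z s B} → d < size z → u d ≤ s - α (size z) → 0# ≤ B →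
      (∀ y → Support (h z) y → ∀ i → d < size (lookup y i) →
        ℙ[ W (lookup y i) > (s - α (size z)) * g₂ (size (lookup y i)) ] ≤
        g₁ (size (lookup y i)) * (size (lookup y i) * B)) →
      ℙ[ W z > s * g₂ (size z) ] ≤ g₁ (size z) * (m (size z) * B)
    one-step {z} {s} {B} large ud≤s′ 0≤B children with recurrence z large
    ... | C , bound with bound (s * g₂ (size z)) | mean-max z
    ... | p , p-sum , tail≤p | e , e-sum , e≤m = begin
        ℙ[ W z > s * g₂ x ] ≤⟨ tail≤p ⟩
        p                   ≤⟨ hasSum-≤* 0≤c p-sum e-sum weighted ⟩
        c * e               ≤⟨ *-monoʳ-≤ 0≤c e≤m ⟩
        c * m x             ≈⟨ *-assoc (g₁ x) B (m x) ⟩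
        g₁ x * (B * m x)    ≈⟨ *-congˡ (*-comm B (m x)) ⟩
        g₁ x * (m x * B)    ∎
      where
      x s′ c r : ℝ
      x  = size z
      s′ = s - α x
      c  = g₁ x * B
      r  = s * g₂ x - a x

      0≤c : 0# ≤ c
      0≤c = *-nonneg (g₁-nonneg x) 0≤B

      r≈ : r ≈ s′ * g₂ x
      r≈ = sym (trans ([y-z]x≈yx-zx (g₂ x) s (α x)) (+-congˡ (-‿cong (x/y*y≈x (a x) (g₂-pos x)))))

      module _ (y : Vec I n) (y∈ : Support (h z) y) where
        open Coupling (C y) renaming (space to S)
        open ProbabilityBounds classical ℛ S

        xᵢ : Fin n → ℝ
        xᵢ i = size (lookup y i)

        M : ℝ
        M = maximum (map size y)

        0≤MB : 0# ≤ M * B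
        0≤MB = *-nonneg (maximum-nonneg (map size y)) 0≤B

        exceeds : Fin n → Pred Ω 0ℓ
        exceeds i ω = s′ * g₂ (xᵢ i) < joint i ω

        -- If no child exceeds its share, the sum is at most `s′` times the sum of the `g₂ (xᵢ i)`.
        -- Passing to `s′ * g₂ x` needs `0# ≤ s′`, which comes from `0≤u-d`.
        cover : (λ ω → r < sum (λ i → joint i ω)) ⊆ ⋃ (Fin n) exceeds
        cover {ω} r<Σ = decidable-stable classical λ none → <⇒≱ r<Σ (begin
          sum (λ i → joint i ω)      ≤⟨ sum-mono (λ i → decidable-stable classical λ ≰ → none (i , ≰⇒> ≰)) ⟩
          sum (λ i → s′ * g₂ (xᵢ i)) ≈⟨ *-distribˡ-sum s′ (λ i → g₂ (xᵢ i)) ⟨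
          s′ * sum (λ i → g₂ (xᵢ i)) ≤⟨ *-monoʳ-≤ (≤-trans (0≤u-d z) ud≤s′) (proj₂ (g-split z large y y∈)) ⟩
          s′ * g₂ x                  ≈⟨ r≈ ⟨
          r                          ∎)

        -- Replacing each child's size by the maximum `M` leaves a common factor `M * B`, so that
        -- only the `g₁ (xᵢ i)` remain to be summed.
        child : ∀ i → ℙ (exceeds i) ≤ g₁ (xᵢ i) * (M * B)
        child i with classical {P = xᵢ i ≤ d}
        ... | yes small = begin
          ℙ (exceeds i)                            ≈⟨ marginal i _ ⟩
          ℙ[ W (lookup y i) > s′ * g₂ (xᵢ i) ]     ≤⟨ small-tail small ud≤s′ ⟩
          0#                                       ≤⟨ *-nonneg (g₁-nonneg _) 0≤MB ⟩
          g₁ (xᵢ i) * (M * B)                      ∎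
        ... | no xᵢ≰d = begin
          ℙ (exceeds i)                            ≈⟨ marginal i _ ⟩
          ℙ[ W (lookup y i) > s′ * g₂ (xᵢ i) ]     ≤⟨ children y y∈ i (≰⇒> xᵢ≰d) ⟩
          g₁ (xᵢ i) * (xᵢ i * B)
            ≤⟨ *-monoʳ-≤ (g₁-nonneg _) (*-monoˡ-≤ 0≤B (lookup≤maximum size y i)) ⟩
          g₁ (xᵢ i) * (M * B)                      ∎

        joint-tail : ℙ[Σ C y > r ] ≤ c * M
        joint-tail = begin
          ℙ[Σ C y > r ]
            ≤⟨ ℙ-union-bound (λ i → measurable i _) (measurable-sum measurable r) cover ⟩
          sum (λ i → ℙ (exceeds i))          ≤⟨ sum-mono child ⟩
          sum (λ i → g₁ (xᵢ i) * (M * B))    ≈⟨ *-distribʳ-sum (M * B) (λ i → g₁ (xᵢ i)) ⟨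
          sum (λ i → g₁ (xᵢ i)) * (M * B)    ≤⟨ *-monoˡ-≤ 0≤MB (proj₁ (g-split z large y y∈)) ⟩
          g₁ x * (M * B)                     ≈⟨ *-congˡ (*-comm M B) ⟩
          g₁ x * (B * M)                     ≈⟨ *-assoc (g₁ x) B M ⟨
          c * M                              ∎

      weighted : ∀ y → mass (h z) y * ℙ[Σ C y > r ] ≤ c * (mass (h z) y * maximum (map size y))
      weighted y with classical {P = mass (h z) y ≤ 0#}
      -- Off the support `g-split` says nothing, but both sides vanish.
      ... | yes mass≤0 = ≤-reflexive (begin-equality
          mass (h z) y * ℙ[Σ C y > r ]  ≈⟨ *-congʳ mass≈0 ⟩
          0# * ℙ[Σ C y > r ]            ≈⟨ zeroˡ _ ⟩
          0#                            ≈⟨ zeroʳ c ⟨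
          c * 0#                        ≈⟨ *-congˡ (trans (*-congʳ mass≈0) (zeroˡ _)) ⟨
          c * (mass (h z) y * maximum (map size y)) ∎)
        where
        mass≈0 : mass (h z) y ≈ 0#
        mass≈0 = antisym mass≤0 (mass-nonneg (h z) y)
      ... | no mass≰0 = begin
          mass (h z) y * ℙ[Σ C y > r ]
            ≤⟨ *-monoʳ-≤ (mass-nonneg (h z) y) (joint-tail y (≰⇒> mass≰0)) ⟩
          mass (h z) y * (c * maximum (map size y))     ≈⟨ x∙yz≈y∙xz _ _ _ ⟩
          c * (mass (h z) y * maximum (map size y))     ∎

    -- The Markov-type bound.

    trivial : ∀ {z r t} → d < size z → 1# ≤ t → ℙ[ W z > r ] ≤ g₁ (size z) * t
    trivial {z} {r} {t} large 1≤t = begin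
      ℙ[ W z > r ]     ≤⟨ tail≤1 z r ⟩
      1#               ≤⟨ 1≤g₁ _ large ⟩
      g₁ (size z)      ≈⟨ *-identityʳ _ ⟨
      g₁ (size z) * 1# ≤⟨ *-monoʳ-≤ (g₁-nonneg _) 1≤t ⟩
      g₁ (size z) * t  ∎

    1≤x/y : ∀ {x y} → 0# < y → y ≤ x → 1# ≤ x / y
    1≤x/y {x} {y} 0<y y≤x = x≤y/z 0<y (≤-respˡ-≈ (sym (*-identityˡ y)) y≤x)

    -- Since `α x ≤ α y`, subtracting `α x` from `s` leaves at least `u y - α y`, and `u-step` puts
    -- this above `u (m y)`. Thus one unfolding moves the level from `y` to `m y`.
    u-m≤ : ∀ {x y s} → d < x → x ≤ y → u y ≤ s → u (m y) ≤ s - α x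
    u-m≤ {x} {y} {s} d<x x≤y uy≤s = x+y≤z⇒x≤z-y (begin
      u (m y) + α x ≤⟨ +-monoʳ-≤ (u (m y)) (α-mono x y d<x x≤y) ⟩
      u (m y) + α y ≈⟨ +-comm (u (m y)) (α y) ⟩
      α y + u (m y) ≤⟨ u-step y (≤-trans (<⇒≤ (0<large d<x)) x≤y) ⟩
      u y           ≤⟨ uy≤s ⟩
      s             ∎)

    -- Induction on the depth `k` after which no descendant is large, with `s` and `q` free to
    -- become `s - α x` and `m q`. Depth 0 contradicts `d < size z`.
    markov-tail : ∀ k {z s q} → Avoids h Large k z → d < size z → d < q → u q ≤ s →
                  ℙ[ W z > s * g₂ (size z) ] ≤ g₁ (size z) * (size z / q)
    markov-tail zero avoids large = contradiction large (avoids-zero avoids)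
    markov-tail (suc k) {z} {s} {q} avoids large d<q uq≤s with classical {P = q ≤ size z}
    ... | yes q≤x = trivial large (1≤x/y (0<large d<q) q≤x)
    ... | no  q≰x = by-mean classical
      where
      x : ℝ
      x = size z

      x≤q : x ≤ q
      x≤q = ≰⇒≥ q≰x

      um≤s′ : u (m q) ≤ s - α x
      um≤s′ = u-m≤ large x≤q uq≤s

      ud≤s′ : u d ≤ s - α x
      ud≤s′ = ≤-trans (u-d≤u (m q)) um≤s′

      by-mean : Dec (m x ≤ 0#) → ℙ[ W z > s * g₂ x ] ≤ g₁ x * (x / q)
      -- Here `m q` may vanish, so it cannot be a denominator. But the mean maximal size is at most
      -- 0, so no child in the support is large, and `one-step` applies with `B = 0#`.
      by-mean (yes m≤0) = begin
        ℙ[ W z > s * g₂ x ] ≤⟨ one-step large ud≤s′ ≤-refl no-large ⟩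
        g₁ x * (m x * 0#)   ≤⟨ *-monoʳ-≤ (g₁-nonneg x) (≤-respˡ-≈ (sym (zeroʳ (m x))) 0≤x/q) ⟩
        g₁ x * (x / q)      ∎
        where
        0≤x/q : 0# ≤ x / q
        0≤x/q = *-nonneg (size-nonneg z) (<⇒≤ (0<x⇒0<x⁻¹ (0<large d<q)))

        no-large : ∀ y → Support (h z) y → ∀ i → d < size (lookup y i) → _
        no-large y y∈ i d<xᵢ with mean-max z
        ... | e , e-sum , e≤m = contradiction
          (≤-trans (lookup≤maximum size y i)
            (*≤0⇒≤0 y∈ (≤-trans (hasSum-term e-sum y) (≤-trans e≤m m≤0))))
          (<⇒≱ (0<large d<xᵢ))
      by-mean (no m≰0) = begin
        ℙ[ W z > s * g₂ x ] ≤⟨ one-step large ud≤s′ (<⇒≤ (0<x⇒0<x⁻¹ 0<mq)) child ⟩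
        g₁ x * (m x / m q)  ≤⟨ *-monoʳ-≤ (g₁-nonneg x) mx/mq≤x/q ⟩
        g₁ x * (x / q)      ∎
        where
        0<x : 0# < x
        0<x = 0<large large
        0<q : 0# < q
        0<q = 0<large d<q

        mx≤x/q*mq : m x ≤ x / q * m q
        mx≤x/q*mq = begin
          m x              ≈⟨ x/y*y≈x (m x) 0<x ⟨
          m x / x * x      ≤⟨ *-monoˡ-≤ (<⇒≤ 0<x) (m/x-mono x q 0<x x≤q) ⟩
          m q * q ⁻¹ * x   ≈⟨ *-comm _ x ⟩
          x * (m q * q ⁻¹) ≈⟨ *-congˡ (*-comm (m q) (q ⁻¹)) ⟩
          x * (q ⁻¹ * m q) ≈⟨ *-assoc x (q ⁻¹) (m q) ⟨
          x / q * m q      ∎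

        -- A non-positive `m q` would force `m x` to be non-positive too, as `m x / x ≤ m q / q`.
        0<mq : 0# < m q
        0<mq = ≰⇒> λ mq≤0 → m≰0 (begin
          m x          ≤⟨ mx≤x/q*mq ⟩
          x / q * m q  ≤⟨ *-monoʳ-≤ (<⇒≤ (*-pos 0<x (0<x⇒0<x⁻¹ 0<q))) mq≤0 ⟩
          x / q * 0#   ≈⟨ zeroʳ _ ⟩
          0#           ∎)

        mx/mq≤x/q : m x / m q ≤ x / q
        mx/mq≤x/q = *-cancelʳ-≤ 0<mq (≤-respˡ-≈ (sym (x/y*y≈x (m x) 0<mq)) mx≤x/q*mq)

        child : ∀ y → Support (h z) y → ∀ i → d < size (lookup y i) →
          ℙ[ W (lookup y i) > (s - α x) * g₂ (size (lookup y i)) ] ≤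
          g₁ (size (lookup y i)) * (size (lookup y i) / m q)
        -- The induction hypothesis demands `d < m q`. This follows from `d < xᵢ` when `xᵢ < m q`;
        -- otherwise the bound is trivial.
        child y y∈ i d<xᵢ with classical {P = m q ≤ size (lookup y i)}
        ... | yes mq≤xᵢ = trivial d<xᵢ (1≤x/y 0<mq mq≤xᵢ)
        ... | no  mq≰xᵢ = markov-tail k (avoids-suc avoids y∈ i) d<xᵢ (<-trans d<xᵢ (≰⇒> mq≰xᵢ)) um≤s′

    -- Repeated unfolding at a fixed level.

    x-y*0≈x : ∀ x y → x - y * 0# ≈ x
    x-y*0≈x x y = trans (+-congˡ (trans (-‿cong (zeroʳ y)) -0#≈0#)) (+-identityʳ x)

    x*suc : ∀ x k → x * fromℕ (suc k) ≈ x + x * fromℕ k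
    x*suc x k = trans (distribˡ x 1# (fromℕ k)) (+-congʳ (*-identityʳ x))

    0≤ρ : ∀ {x} → d < x → 0# ≤ ρ x
    0≤ρ d<x = *-nonneg (proj₁ (m-bounds _ (<⇒≤ (0<large d<x)))) (<⇒≤ (0<x⇒0<x⁻¹ (0<large d<x)))

    -- Each unfolding contributes a factor `m x`, that is `x * ρ x`, and the children's bounds can
    -- be stated with the parent's data because `ρ` and `α` grow with the size. The bound has the
    -- form `size z * B` so that it can be fed back into `one-step`.
    power-tail : ∀ k {z s q} → d < size z → d < q → u q ≤ s - α (size z) * fromℕ k →
                 ℙ[ W z > s * g₂ (size z) ] ≤ g₁ (size z) * (size z * (ρ (size z) ^ k / q))
    power-tail zero {z} {s} {q} large d<q uq≤s = begin
      ℙ[ W z > s * g₂ x ]      ≤⟨ markov-tail _ (proj₂ (terminates z)) large d<q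
                                     (≤-respʳ-≈ (x-y*0≈x s (α x)) uq≤s) ⟩
      g₁ x * (x / q)           ≈⟨ *-congˡ (*-congˡ (*-identityˡ (q ⁻¹))) ⟨
      g₁ x * (x * (1# / q))    ∎
      where
      x : ℝ
      x = size z
    power-tail (suc k) {z} {s} {q} large d<q uq≤s = begin
      ℙ[ W z > s * g₂ x ]                ≤⟨ one-step large ud≤s′ (*-nonneg (^-nonneg 0≤ρx k) (<⇒≤ 0<q⁻¹)) child ⟩
      g₁ x * (m x * (ρ x ^ k / q))       ≈⟨ *-congˡ regroup ⟩
      g₁ x * (x * (ρ x ^ suc k / q))     ∎
      where
      x s′ : ℝ
      x  = size z
      s′ = s - α x

      0≤ρx : 0# ≤ ρ x
      0≤ρx = 0≤ρ large

      0<q⁻¹ : 0# < q ⁻¹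
      0<q⁻¹ = 0<x⇒0<x⁻¹ (0<large d<q)

      regroup : m x * (ρ x ^ k / q) ≈ x * (ρ x ^ suc k / q)
      regroup = begin-equality
        m x * (ρ x ^ k / q)         ≈⟨ *-congʳ (x/y*y≈x (m x) (0<large large)) ⟨
        ρ x * x * (ρ x ^ k / q)     ≈⟨ *-congʳ (*-comm (ρ x) x) ⟩
        x * ρ x * (ρ x ^ k / q)     ≈⟨ *-assoc x (ρ x) _ ⟩
        x * (ρ x * (ρ x ^ k / q))   ≈⟨ *-congˡ (*-assoc (ρ x) _ (q ⁻¹)) ⟨
        x * (ρ x ^ suc k / q)       ∎

      -- The current unfolding spends one of the `suc k` copies of `α x`; the others remain for the
      -- children.
      uq+αk≤s′ : u q + α x * fromℕ k ≤ s′
      uq+αk≤s′ = x+y≤z⇒x≤z-y (begin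
        (u q + α x * fromℕ k) + α x  ≈⟨ +-assoc _ _ _ ⟩
        u q + (α x * fromℕ k + α x)  ≈⟨ +-congˡ (trans (+-comm _ _) (sym (x*suc (α x) k))) ⟩
        u q + α x * fromℕ (suc k)    ≤⟨ x≤z-y⇒x+y≤z uq≤s ⟩
        s                            ∎)

      ud≤s′ : u d ≤ s′
      ud≤s′ = begin
        u d                    ≤⟨ u-mono (<⇒≤ d<q) ⟩
        u q                    ≈⟨ +-identityʳ (u q) ⟨
        u q + 0#               ≤⟨ +-monoʳ-≤ (u q) (*-nonneg (<⇒≤ (α-pos x large)) (fromℕ-nonneg k)) ⟩
        u q + α x * fromℕ k    ≤⟨ uq+αk≤s′ ⟩
        s′                     ∎

      child : ∀ y → Support (h z) y → ∀ i → d < size (lookup y i) →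
        ℙ[ W (lookup y i) > s′ * g₂ (size (lookup y i)) ] ≤
        g₁ (size (lookup y i)) * (size (lookup y i) * (ρ x ^ k / q))
      child y y∈ i d<xᵢ = begin
        ℙ[ W (lookup y i) > s′ * g₂ xᵢ ]   ≤⟨ power-tail k d<xᵢ d<q (x+y≤z⇒x≤z-y uq+αᵢk≤s′) ⟩
        g₁ xᵢ * (xᵢ * (ρ xᵢ ^ k / q))      ≤⟨ *-monoʳ-≤ (g₁-nonneg xᵢ)
                                                  (*-monoʳ-≤ (size-nonneg (lookup y i)) ρᵢᵏ/q≤ρᵏ/q) ⟩
        g₁ xᵢ * (xᵢ * (ρ x ^ k / q))       ∎
        where
        xᵢ : ℝ
        xᵢ = size (lookup y i)
        xᵢ≤x : xᵢ ≤ x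
        xᵢ≤x = size-split z y y∈ i
        ρᵢᵏ/q≤ρᵏ/q : ρ xᵢ ^ k / q ≤ ρ x ^ k / q
        ρᵢᵏ/q≤ρᵏ/q = *-monoˡ-≤ (<⇒≤ 0<q⁻¹)
          (^-monoˡ-≤ (0≤ρ d<xᵢ) (m/x-mono xᵢ x (0<large d<xᵢ) xᵢ≤x) k)
        uq+αᵢk≤s′ : u q + α xᵢ * fromℕ k ≤ s′
        uq+αᵢk≤s′ = ≤-trans (+-monoʳ-≤ (u q) (*-monoˡ-≤ (fromℕ-nonneg k) (α-mono xᵢ x d<xᵢ xᵢ≤x))) uq+αk≤s′

    -- This makes `u′` invertible at the level used in `D`. If the ceiling is `suc k`, minimality
    -- gives `α x * k < s - u x`; one more `α x` still fits, because `u x` exceeds `u (m x)`, and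
    -- hence `u d`, by at least `α x`.
    ceiling-level : ∀ {x s} → d < x → u d < s → u d < s - α x * fromℕ ⌈ (s - u x) / α x ⌉
    ceiling-level {x} {s} d<x ud<s with ceiling ((s - u x) / α x)
    -- `ceiling` is 0 when its argument is not positive; the level is then `s` itself.
    ... | zero  , _ , _ = <-≤-trans ud<s (≤-reflexive (sym (x-y*0≈x s (α x))))
    ... | suc k , _ , least = +-cancelʳ-< (α x * fromℕ (suc k)) (begin-strict
        u d + α x * fromℕ (suc k)              ≈⟨ +-congˡ (x*suc (α x) k) ⟩
        u d + (α x + α x * fromℕ k)            ≤⟨ +-monoˡ-≤ _ (u-d≤u (m x)) ⟩
        u (m x) + (α x + α x * fromℕ k)        ≈⟨ +-assoc _ _ _ ⟨
        (u (m x) + α x) + α x * fromℕ k        ≤⟨ +-monoˡ-≤ _ (x≤z-y⇒x+y≤z (u-m≤ d<x ≤-refl ≤-refl)) ⟩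
        u x + α x * fromℕ k                    ≈⟨ +-comm _ _ ⟩
        α x * fromℕ k + u x                    ≈⟨ +-congʳ (*-comm (α x) (fromℕ k)) ⟩
        fromℕ k * α x + u x                    <⟨ +-monoˡ-< (u x) (*-monoˡ-< 0<α (≰⇒> λ ≤k → ℕ.1+n≰n (least k ≤k))) ⟩
        (s - u x) / α x * α x + u x            ≈⟨ +-congʳ (x/y*y≈x _ 0<α) ⟩
        (s - u x) + u x                        ≈⟨ x-y+y≈x s (u x) ⟩
        s                                      ≈⟨ x-y+y≈x s _ ⟨
        s - α x * fromℕ (suc k) + α x * fromℕ (suc k) ∎)
      where
      0<α : 0# < α x
      0<α = α-pos x d<x

    -- Matching the bound with the cases of `D`.

    module _ (u′ : ℝ → ℝ) (u-u′ : ∀ y → u d < y → u (u′ y) ≈ y) where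

      tail≤D : ∀ {z s} → 1# ≤ g₁ (size z) →
               ℙ[ W z > s * g₂ (size z) ] ≤ g₁ (size z) * D d m α u u′ s (size z)
      tail≤D {z} {s} 1≤g = by-cases (s ≤? u d) (λ _ → ≤g₁)
        λ s≰ud → by-cases (x ≤? d) (λ x≤d → ≤-respʳ-≈ (sym (zeroʳ _)) (small-tail x≤d (≰⇒≥ s≰ud)))
        λ x≰d → by-cases (s ≤? u x) (λ _ → ≤g₁)
        λ _ → main (≰⇒> x≰d) (≰⇒> s≰ud)
        where
        x : ℝ
        x = size z

        -- With the decision as a variable, matching on it reduces the conditional, so nested uses
        -- follow the nested conditionals of `D`.
        by-cases : ∀ {P : Set} (P? : Dec P) {b c} →
          (P → ℙ[ W z > s * g₂ x ] ≤ g₁ x * b) → (¬ P → ℙ[ W z > s * g₂ x ] ≤ g₁ x * c) →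
          ℙ[ W z > s * g₂ x ] ≤ g₁ x * (if does P? then b else c)
        by-cases (yes p) if-P if-¬P = if-P p
        by-cases (no ¬p) if-P if-¬P = if-¬P ¬p

        ≤g₁ : ℙ[ W z > s * g₂ x ] ≤ g₁ x * 1#
        ≤g₁ = ≤-trans (tail≤1 z _) (≤-respʳ-≈ (sym (*-identityʳ (g₁ x))) 1≤g)

        main : d < x → u d < s → let k = ⌈ (s - u x) / α x ⌉ in
               ℙ[ W z > s * g₂ x ] ≤ g₁ x * (ρ x ^ k * (x / u′ (s - α x * fromℕ k)))
        main d<x ud<s = ≤-respʳ-≈ (*-congˡ (x∙yz≈y∙xz _ _ _)) (power-tail k d<x d<q (≤-reflexive u-q≈))
          where
          k : ℕ
          k = ⌈ (s - u x) / α x ⌉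
          q : ℝ
          q = u′ (s - α x * fromℕ k)
          level : u d < s - α x * fromℕ k
          level = ceiling-level d<x ud<s
          u-q≈ : u q ≈ s - α x * fromℕ k
          u-q≈ = u-u′ _ level
          -- For `q ≤ d` flatness would give `u q ≈ u d`, yet `u q` equals a level above `u d`.
          d<q : d < q
          d<q = ≰⇒> λ q≤d → <⇒≱ level (≤-respˡ-≈ u-q≈ (≤-reflexive (u-flat q q≤d)))

-- The tail bound at an arbitrary threshold.

theorem7 :
  (classical : Classical) (ℛ : CompleteOrderedField) →
  let open CompleteOrderedField ℛ
      open Probability ℛ
      open Tail classical ℛ
  in
  (I : Set) (size : I → ℝ) → (∀ z → 0# ≤ size z) →
  (n : ℕ) .{{_ : NonZero n}} →
  (d : ℝ) → 0# ≤ d →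
  (h : I → DiscreteLaw (Vec I n)) →
  (∀ z y → Support (h z) y → ∀ i → size (lookup y i) ≤ size z) →
  (W : I → RandomVariable) →
  (∀ z ω → 0# ≤ RandomVariable.value (W z) ω) →
  (a : ℝ → ℝ) → (∀ x → 0# ≤ x → 0# ≤ a x) →
  (∀ z → d < size z → RecurrenceAt h W z (a (size z))) →
  (∀ z → ∃ λ k → (is : Vec (Fin n) k) → HasNestedProb h is (λ w → d < size w) z 0#) →
  (m : ℝ → ℝ) →
  (∀ x → 0# ≤ x → (0# ≤ m x) × (m x ≤ x)) →
  (∀ x y → 0# < x → x ≤ y → m x / x ≤ m y / y) →
  (∀ z → ∃ λ e → HasExpectation (h z) (λ y → maximum (map size y)) e × (e ≤ m (size z))) →
  (g₁ g₂ : ℝ → ℝ) →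
  (∀ x → 0# ≤ g₁ x) → (∀ x → 0# < g₂ x) →
  Monotone g₁ → Monotone g₂ →
  (∀ x → d < x → 1# ≤ g₁ x) →
  (∀ z → d < size z → ∀ y → Support (h z) y →
    (sum (λ i → g₁ (size (lookup y i))) ≤ g₁ (size z)) ×
    (sum (λ i → g₂ (size (lookup y i))) ≤ g₂ (size z))) →
  let α = λ (x : ℝ) → a x / g₂ x in
  (∀ x → 0# ≤ x → x ≤ d → α x ≈ 0#) →
  (∀ x → d < x → 0# < α x) →
  (∀ x y → d < x → x ≤ y → α x ≤ α y) →
  ContinuousAbove d α →
  (u : ℝ → ℝ) →
  Monotone u →
  ContinuousAbove d u →
  (∀ x → 0# ≤ x → α x + u (m x) ≤ u x) →
  (∀ x → x ≤ d → u x ≈ u d) →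
  (∀ z → size z ≤ d → RandomVariable.AlmostSurely (W z)
    (λ ω → RandomVariable.value (W z) ω / g₂ (size z) ≤ u (size z))) →
  (u′ : ℝ → ℝ) →
  (∀ y → 0# ≤ u′ y) →
  (∀ x → d < x → u′ (u x) ≈ x) →
  (∀ y → u d < y → u (u′ y) ≈ y) →
  (z : I) (r : ℝ) →
  1# ≤ g₁ (size z) →
  ℙ[ W z > r ] ≤ g₁ (size z) * D d m α u u′ (r / g₂ (size z)) (size z)
theorem7 classical ℛ I size size-nonneg n d 0≤d h size-split W W-nonneg a _ recurrence terminates
  m m-bounds m/x-mono mean-max g₁ g₂ g₁-nonneg g₂-pos _ _ 1≤g₁ g-split _ α-pos α-mono _
  u u-mono _ u-step u-flat W-small u′ _ _ u-u′ z r 1≤g =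
  -- The thresholds `r` and `r / g₂ (size z) * g₂ (size z)` agree only up to `≈`, so the event is
  -- transferred by monotonicity of `ℙ`.
  ≤-trans (ℙ-mono (measurable r) (measurable _) (≤-<-trans (≤-reflexive (x/y*y≈x r (g₂-pos _)))))
          (tail≤D u′ u-u′ 1≤g)
  where
  open OrderedField classical ℛ
  open Probability.RandomVariable (W z) using (space; measurable)
  open ProbabilityBounds classical ℛ space using (ℙ-mono)
  avoids : ∀ z → ∃ λ k → Termination.Avoids classical ℛ h _ k z
  avoids z with terminates z
  ... | k , nested = k , λ is → _ , nested is , ≤-refl
  open Recurrence.TailBound classical ℛ I size size-nonneg n d 0≤d h size-split W W-nonneg a
    recurrence avoids m m-bounds m/x-mono mean-max g₁ g₂ g₁-nonneg g₂-pos 1≤g₁ g-split α-pos α-mono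
    u u-mono u-step u-flat W-small
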